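{- Let $\mathcal{H}=\{rrb\}$. Then, for every positive integer $n$, $h_2(n,\mathcal{H})=\lceil\sqrt{n}\,\rceil$.
   Context: Edge-colorings of the complete graph $K_n$ use colors from $\{r,b,y\}$ (red, blue, yellow); they need not be proper, and not all colors need be used. A pattern is an edge-colored triangle, denoted by the multiset of the colors of its three edges; e.g. $rrb$ is the triangle with two red edges and one blue edge. For a family $\mathcal{H}$ of patterns, $\operatorname{Forb}(n,\mathcal{H})$ is the set of all edge-colorings of $K_n$ with colors from $\{r,b,y\}$ in which no triangle has a coloring belonging to $\mathcal{H}$. For an edge-coloring $c$ of $K_n$, $h_2(c)$ is the maximum $k$ such that there is a set of $k$ vertices whose induced edges use at most two of the three colors. Finally, $h_2(n,\mathcal{H})=\min\{h_2(c): c\in\operatorname{Forb}(n,\mathcal{H})\}$. -}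

module Defs where

open import Level using (0ℓ)
open import Data.Nat using (ℕ; zero; suc; _*_; _≤_; z≤n; s≤s; _≤?_)
open import Data.Nat.Properties
  using (_≟_; ≤∧≢⇒<; m≤m*n; ≤-pred)
open import Data.Fin using (Fin)
import Data.Fin.Properties as Fin
open import Data.Fin.Subset using (Subset; _∈_; ∣_∣; ⊥)
open import Data.Fin.Subset.Properties
  using (_∈?_; ∉⊥; ∣⊥∣≡0; ∣p∣≤n; anySubset?)
open import Data.List using (_∷_; [])
open import Data.List.Relation.Binary.Permutation.Propositional using (_↭_)
open import Data.Product using (Σ; ∃; ∃-syntax; _×_; _,_; proj₁)
open import Data.Sum using (_⊎_; inj₁; inj₂; [_,_]′)
open import Data.Vec using (Vec; toList; _∷_; [])
open import Function using (_∘_)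
open import Relation.Binary.Definitions using (DecidableEquality)
open import Relation.Binary.PropositionalEquality
  using (_≡_; _≢_; refl)
open import Relation.Nullary using (¬_; Dec; yes; no; contradiction)
open import Relation.Nullary.Decidable
  using (map′; _×-dec_; _⊎-dec_; _→-dec_; ¬?)
open import Relation.Unary using (Pred; Decidable)

IsMaximum : Pred ℕ 0ℓ → Pred ℕ 0ℓ
IsMaximum P m = P m × (∀ k → P k → k ≤ m)

IsMinimum : Pred ℕ 0ℓ → Pred ℕ 0ℓ
IsMinimum P m = P m × (∀ k → P k → m ≤ k)

maximum : ∀ {P : Pred ℕ 0ℓ} → Decidable P → P 0 →
          ∀ n → (∀ k → P k → k ≤ n) → ∃ (IsMaximum P)
maximum P? p₀ zero    bound = zero , p₀ , bound
maximum P? p₀ (suc n) bound with P? (suc n)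
... | yes p = suc n , p , bound
... | no ¬p = maximum P? p₀ n λ k pk →
  ≤-pred (≤∧≢⇒< (bound k pk) λ { refl → ¬p pk })

minimum : ∀ {P : Pred ℕ 0ℓ} → Decidable P → ∀ n → P n → ∃ (IsMinimum P)
minimum P? n pn with P? 0
... | yes p₀ = zero , p₀ , λ _ _ → z≤n
minimum P? zero    pn | no ¬p₀ = contradiction pn ¬p₀
minimum P? (suc n) pn | no ¬p₀ with minimum (P? ∘ suc) n pn
... | m , pm , least = suc m , pm , λ
  { zero    p₀ → contradiction p₀ ¬p₀
  ; (suc k) pk → s≤s (least k pk)
  }

-- For natural numbers m and n, √n ≤ m holds exactly when n ≤ m * m, so the
-- ceiling of √n is the least such m.
ceilSqrt : ∀ n → ∃ (IsMinimum λ m → n ≤ m * m)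
ceilSqrt n = minimum (λ m → n ≤? m * m) n (n≤n² n)
  where
  n≤n² : ∀ n → n ≤ n * n
  n≤n² zero    = z≤n
  n≤n² (suc n) = m≤m*n (suc n) (suc n)

⌈√_⌉ : ℕ → ℕ
⌈√ n ⌉ = proj₁ (ceilSqrt n)

data Color : Set where
  r b y : Color

_≟ᶜ_ : DecidableEquality Color
r ≟ᶜ r = yes refl
r ≟ᶜ b = no λ ()
r ≟ᶜ y = no λ ()
b ≟ᶜ r = no λ ()
b ≟ᶜ b = yes refl
b ≟ᶜ y = no λ ()
y ≟ᶜ r = no λ ()
y ≟ᶜ b = no λ ()
y ≟ᶜ y = yes refl

anyColor? : ∀ {P : Pred Color 0ℓ} → Decidable P → Dec (∃ P)
anyColor? P? = map′
  [ (r ,_) , [ (b ,_) , (y ,_) ]′ ]′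
  (λ { (r , p) → inj₁ p ; (b , p) → inj₂ (inj₁ p) ; (y , p) → inj₂ (inj₂ p) })
  (P? r ⊎-dec (P? b ⊎-dec P? y))

-- The diagonal values color i i carry no meaning; nothing below inspects them.
record EdgeColoring (n : ℕ) : Set where
  field
    color     : Fin n → Fin n → Color
    color-sym : ∀ i j → color i j ≡ color j i

open EdgeColoring public

-- A pattern is a multiset of three colors, written in any order: patterns are
-- only ever compared up to permutation.
Pattern : Set
Pattern = Vec Color 3

rrb : Pattern
rrb = r ∷ r ∷ b ∷ []

HasPattern : ∀ {n} → EdgeColoring n → (i j k : Fin n) → Pattern → Set
HasPattern c i j k p =
  toList p ↭ color c i j ∷ color c j k ∷ color c i k ∷ []

Forb : ∀ n → Pred Pattern 0ℓ → Pred (EdgeColoring n) 0ℓ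
Forb n ℋ c = ∀ i j k → i ≢ j → j ≢ k → i ≢ k →
  ¬ (∃[ p ] (ℋ p × HasPattern c i j k p))

-- The colors p and q may coincide.
AtMostTwoColors : ∀ {n} → EdgeColoring n → Pred (Subset n) 0ℓ
AtMostTwoColors c S = ∃[ p ] ∃[ q ] (∀ i j → i ∈ S → j ∈ S → i ≢ j →
  color c i j ≡ p ⊎ color c i j ≡ q)

atMostTwoColors? : ∀ {n} (c : EdgeColoring n) → Decidable (AtMostTwoColors c)
atMostTwoColors? c S = anyColor? λ p → anyColor? λ q →
  Fin.all? λ i → Fin.all? λ j →
    (i ∈? S) →-dec (j ∈? S) →-dec ¬? (i Fin.≟ j) →-dec
    ((color c i j ≟ᶜ p) ⊎-dec (color c i j ≟ᶜ q))

TwoColoredSetOfSize : ∀ {n} → EdgeColoring n → Pred ℕ 0ℓ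
TwoColoredSetOfSize {n} c k =
  Σ (Subset n) λ S → ∣ S ∣ ≡ k × AtMostTwoColors c S

maxTwoColoredSet : ∀ {n} (c : EdgeColoring n) →
                   ∃ (IsMaximum (TwoColoredSetOfSize c))
maxTwoColoredSet {n} c = maximum
  (λ k → anySubset? λ S → (∣ S ∣ ≟ k) ×-dec atMostTwoColors? c S)
  (⊥ , ∣⊥∣≡0 n , r , r , λ i j i∈⊥ → contradiction i∈⊥ ∉⊥)
  n
  (λ { k (S , refl , _) → ∣p∣≤n S })

h₂ : ∀ {n} → EdgeColoring n → ℕ
h₂ c = proj₁ (maxTwoColoredSet c)

-- h₂[ n , ℋ ]≡ m says that the minimum of h₂ over Forb n ℋ exists and is m. It
-- is a relation rather than a function of n and ℋ because Forb n ℋ may be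
-- empty for some families ℋ.
h₂[_,_]≡_ : ℕ → Pred Pattern 0ℓ → ℕ → Set
h₂[ n , ℋ ]≡ m =
  IsMinimum (λ k → Σ (EdgeColoring n) λ c → Forb n ℋ c × h₂ c ≡ k) m

{-# OPTIONS --safe #-}

-- Lower bound: when rrb is forbidden, a vertex together with its red neighbors
-- spans no blue edge, so every closed red neighborhood has at most h₂ vertices.
-- Greedily, some set without red edges has at least n / h₂ vertices; as it is
-- two-colored, n / h₂ ≤ h₂.
--
-- Upper bound: place the vertices in an m × m grid, color the pairs in a common
-- row red, those in a common column blue, and all others yellow. Red is then
-- transitive, and a set that avoids one of the colors meets every row at most
-- once or every column at most once.
module Submission where

open import Data.Bool using (Bool; true; false)
open import Data.Fin using (Fin; zero; suc; _≟_; inject≤; remQuot; combine)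
import Data.Fin.Properties as Fin
open import Data.Fin.Subset
open import Data.Fin.Subset.Induction using (⊂-wellFounded)
open import Data.Fin.Subset.Properties
open import Data.List using ([]; _∷_)
open import Data.List.Relation.Binary.Permutation.Propositional using (_↭_)
open import Data.List.Relation.Binary.Permutation.Propositional.Properties
  using (All-resp-↭; Any-resp-↭; drop-mid)
open import Data.List.Relation.Unary.All using ([]; _∷_)
open import Data.List.Relation.Unary.Any using (here; there)
open import Data.Nat using (ℕ; suc; _+_; _*_; _≤_; z≤n; s≤s; NonZero)
open import Data.Nat.Properties
  using (≤-trans; ≤-antisym; m≤n⇒m≤1+n; +-suc; +-mono-≤; *-monoˡ-≤;
         module ≤-Reasoning)
open import Data.Product using (∃; ∃-syntax; _×_; _,_; proj₁; proj₂; uncurry)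
open import Data.Sum using (_⊎_; inj₁; inj₂; [_,_]′)
open import Data.Vec using ([]; _∷_; here; there; tabulate)
open import Data.Vec.Properties using (lookup∘tabulate; lookup⇒[]=; []=⇒lookup)
open import Function using (_∘_; mk⇔)
open import Induction.WellFounded using (Acc; acc)
open import Level using (0ℓ)
open import Relation.Binary.PropositionalEquality
open import Relation.Nullary using (yes; no; does; contradiction)
open import Relation.Nullary.Decidable
  using (_×-dec_; _→-dec_; ¬?; dec-true; does-⇔; decidable-stable)
open import Relation.Unary using (Pred; Decidable; ｛_｝)
open import Defs

private variable
  n m : ℕ

-- Subsets of finite sets: comprehension and cardinality.

module _ {P : Pred (Fin n) 0ℓ} (P? : Decidable P) where

  subsetOf : Subset n
  subsetOf = tabulate (does ∘ P?)

  ∈-subsetOf⁺ : ∀ {i} → P i → i ∈ subsetOf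
  ∈-subsetOf⁺ {i} p = lookup⇒[]= i subsetOf
    (trans (lookup∘tabulate (does ∘ P?) i) (dec-true (P? i) p))

  ∈-subsetOf⁻ : ∀ {i} → i ∈ subsetOf → P i
  ∈-subsetOf⁻ {i} i∈ with P? i
    | trans (sym (lookup∘tabulate (does ∘ P?) i)) ([]=⇒lookup i∈)
  ... | yes p | _ = p

∣p∣≤∣q∣+∣p∩∁q∣ : (p q : Subset n) → ∣ p ∣ ≤ ∣ q ∣ + ∣ p ∩ ∁ q ∣
∣p∣≤∣q∣+∣p∩∁q∣ [] [] = z≤n
∣p∣≤∣q∣+∣p∩∁q∣ (outside ∷ p) (outside ∷ q) = ∣p∣≤∣q∣+∣p∩∁q∣ p q
∣p∣≤∣q∣+∣p∩∁q∣ (outside ∷ p) (inside  ∷ q) = m≤n⇒m≤1+n (∣p∣≤∣q∣+∣p∩∁q∣ p q)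
∣p∣≤∣q∣+∣p∩∁q∣ (inside  ∷ p) (inside  ∷ q) = s≤s (∣p∣≤∣q∣+∣p∩∁q∣ p q)
∣p∣≤∣q∣+∣p∩∁q∣ (inside  ∷ p) (outside ∷ q)
  rewrite +-suc ∣ q ∣ ∣ p ∩ ∁ q ∣ = s≤s (∣p∣≤∣q∣+∣p∩∁q∣ p q)

InjectiveOn : {A : Set} → Subset n → (Fin n → A) → Set
InjectiveOn p f = ∀ {i j} → i ∈ p → j ∈ p → f i ≡ f j → i ≡ j

-- Induction on `p`: once `zero` is matched with `f zero`, injectivity keeps the other images inside
-- `q - f zero`, which is strictly smaller than `q`.
injectiveOn⇒∣p∣≤∣q∣ : (p : Subset n) (q : Subset m) {f : Fin n → Fin m} →
  InjectiveOn p f → (∀ {i} → i ∈ p → f i ∈ q) → ∣ p ∣ ≤ ∣ q ∣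
injectiveOn⇒∣p∣≤∣q∣ [] q inj into = z≤n
injectiveOn⇒∣p∣≤∣q∣ (outside ∷ p) q inj into = injectiveOn⇒∣p∣≤∣q∣ p q
  (λ i∈ j∈ → Fin.suc-injective ∘ inj (there i∈) (there j∈)) (into ∘ there)
injectiveOn⇒∣p∣≤∣q∣ (inside ∷ p) q {f} inj into = ≤-trans
  (s≤s (injectiveOn⇒∣p∣≤∣q∣ p (q - f zero)
    (λ i∈ j∈ → Fin.suc-injective ∘ inj (there i∈) (there j∈))
    (λ i∈ → x∈p∧x≢y⇒x∈p-y (into (there i∈))
      λ eq → contradiction (inj (there i∈) here eq) λ ())))
  (x∈p⇒∣p-x∣<∣p∣ (into here))

injectiveOn⇒∣p∣≤m : {p : Subset n} {f : Fin n → Fin m} → InjectiveOn p f → ∣ p ∣ ≤ m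
injectiveOn⇒∣p∣≤m {m = m} {p = p} inj =
  ≤-trans (injectiveOn⇒∣p∣≤∣q∣ p ⊤ inj λ _ → ∈⊤) (∣p∣≤n {m} ⊤)

-- Independent sets in a graph with closed neighborhoods `N` of size at most `d`.

module _ (N : Fin n → Subset n) (N-refl : ∀ i → i ∈ N i)
         (N-sym : ∀ {i j} → j ∈ N i → i ∈ N j)
         {d : ℕ} (∣N∣≤d : ∀ i → ∣ N i ∣ ≤ d) where

  Independent : Pred (Subset n) 0ℓ
  Independent I = ∀ {i j} → i ∈ I → j ∈ I → i ≢ j → j ∉ N i

  -- Choosing a vertex `v` of `S` and discarding `N v` costs at most `d` vertices of `S` and adds
  -- one vertex to the independent set.
  greedy : (S : Subset n) → Acc _⊂_ S →
           ∃[ I ] I ⊆ S × Independent I × ∣ S ∣ ≤ ∣ I ∣ * d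
  greedy S (acc rec) with nonempty? S
  ... | no empty rewrite Empty-unique empty =
    ⊥ , ⊆-refl , (λ i∈⊥ → contradiction i∈⊥ ∉⊥)
      , subst (_≤ ∣ ⊥ {n} ∣ * d) (sym (∣⊥∣≡0 n)) z≤n
  -- By `N-refl`, `v` itself is discarded, so the recursion runs on a proper subset.
  ... | yes (v , v∈S) with greedy (S ∩ ∁ (N v)) (rec (p∩q⊆p S _ , v , v∈S ,
        λ v∈ → x∈∁p⇒x∉p (p∩q⊆q S _ v∈) (N-refl v)))
  ... | I , I⊆ , indep , ∣S∩∁N∣≤ =
    I ∪ ⁅ v ⁆ , I∪v⊆S , indep′ , (begin
      ∣ S ∣                         ≤⟨ ∣p∣≤∣q∣+∣p∩∁q∣ S (N v) ⟩
      -- `suc ∣ I ∣ * d` unfolds to `d + ∣ I ∣ * d`.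
      ∣ N v ∣ + ∣ S ∩ ∁ (N v) ∣     ≤⟨ +-mono-≤ (∣N∣≤d v) ∣S∩∁N∣≤ ⟩
      suc ∣ I ∣ * d                 ≤⟨ *-monoˡ-≤ d ∣I∣<∣I∪v∣ ⟩
      ∣ I ∪ ⁅ v ⁆ ∣ * d             ∎)
    where
    open ≤-Reasoning

    I-disjoint-N : ∀ {i} → i ∈ I → i ∉ N v
    I-disjoint-N i∈I = x∈∁p⇒x∉p (p∩q⊆q S _ (I⊆ i∈I))

    ∣I∣<∣I∪v∣ : suc ∣ I ∣ ≤ ∣ I ∪ ⁅ v ⁆ ∣
    ∣I∣<∣I∪v∣ = p⊂q⇒∣p∣<∣q∣ (p⊆p∪q ⁅ v ⁆ , v , q⊆p∪q I ⁅ v ⁆ (x∈⁅x⁆ v) ,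
      λ v∈I → I-disjoint-N v∈I (N-refl v))

    split : ∀ {i} → i ∈ I ∪ ⁅ v ⁆ → i ∈ I ⊎ i ≡ v
    split i∈ with x∈p∪q⁻ I ⁅ v ⁆ i∈
    ... | inj₁ i∈I = inj₁ i∈I
    ... | inj₂ i∈v = inj₂ (x∈⁅y⁆⇒x≡y v i∈v)

    I∪v⊆S : I ∪ ⁅ v ⁆ ⊆ S
    I∪v⊆S i∈ with split i∈
    ... | inj₁ i∈I  = p∩q⊆p S _ (I⊆ i∈I)
    ... | inj₂ refl = v∈S

    indep′ : Independent (I ∪ ⁅ v ⁆)
    indep′ i∈ j∈ i≢j with split i∈ | split j∈
    ... | inj₁ i∈I  | inj₁ j∈I  = indep i∈I j∈I i≢j
    ... | inj₁ i∈I  | inj₂ refl = I-disjoint-N i∈I ∘ N-sym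
    ... | inj₂ refl | inj₁ j∈I  = I-disjoint-N j∈I
    ... | inj₂ refl | inj₂ refl = contradiction refl i≢j

  largeIndependentSet : ∃[ I ] Independent I × n ≤ ∣ I ∣ * d
  largeIndependentSet with greedy ⊤ (⊂-wellFounded ⊤)
  ... | I , _ , indep , ∣⊤∣≤ = I , indep , subst (_≤ ∣ I ∣ * d) (∣⊤∣≡n n) ∣⊤∣≤

-- Two-colored sets as sets that miss a color.

Avoids : EdgeColoring n → Subset n → Pred Color 0ℓ
Avoids c S z = ∀ {i j} → i ∈ S → j ∈ S → i ≢ j → color c i j ≢ z

otherColors : (z : Color) → ∃[ p ] ∃[ q ] (∀ x → x ≢ z → x ≡ p ⊎ x ≡ q)
otherColors r = b , y , λ
  { r x≢z → contradiction refl x≢z ; b _ → inj₁ refl ; y _ → inj₂ refl }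
otherColors b = r , y , λ
  { r _ → inj₁ refl ; b x≢z → contradiction refl x≢z ; y _ → inj₂ refl }
otherColors y = r , b , λ
  { r _ → inj₁ refl ; b _ → inj₂ refl ; y x≢z → contradiction refl x≢z }

thirdColor : (p q : Color) → ∃[ z ] p ≢ z × q ≢ z
thirdColor r r = b , (λ ()) , λ ()
thirdColor r b = y , (λ ()) , λ ()
thirdColor r y = b , (λ ()) , λ ()
thirdColor b r = y , (λ ()) , λ ()
thirdColor b b = r , (λ ()) , λ ()
thirdColor b y = r , (λ ()) , λ ()
thirdColor y r = b , (λ ()) , λ ()
thirdColor y b = r , (λ ()) , λ ()
thirdColor y y = r , (λ ()) , λ ()

avoids⇒atMostTwoColors : (c : EdgeColoring n) {S : Subset n} {z : Color} →
                         Avoids c S z → AtMostTwoColors c S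
avoids⇒atMostTwoColors c {z = z} avoids with otherColors z
... | p , q , others = p , q , λ i j i∈ j∈ i≢j → others _ (avoids i∈ j∈ i≢j)

atMostTwoColors⇒avoids : (c : EdgeColoring n) {S : Subset n} →
                         AtMostTwoColors c S → ∃ (Avoids c S)
atMostTwoColors⇒avoids c (p , q , two) with thirdColor p q
... | z , p≢z , q≢z = z , λ i∈ j∈ i≢j eq →
  [ (λ eq′ → p≢z (trans (sym eq′) eq)) , (λ eq′ → q≢z (trans (sym eq′) eq)) ]′
    (two _ _ i∈ j∈ i≢j)

avoids⇒∣S∣≤h₂ : (c : EdgeColoring n) {S : Subset n} {z : Color} →
                Avoids c S z → ∣ S ∣ ≤ h₂ c
avoids⇒∣S∣≤h₂ c avoids = proj₂ (proj₂ (maxTwoColoredSet c)) _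
  (_ , refl , avoids⇒atMostTwoColors c avoids)

-- The lower bound on `h₂`.

module _ (c : EdgeColoring n) (rrb-free : Forb n ｛ rrb ｝ c) where

  red² : ∀ {i j k} → i ≢ j → j ≢ k → i ≢ k →
         color c i j ≡ r → color c j k ≡ r → color c i k ≢ b
  red² {i} {j} {k} i≢j j≢k i≢k ij jk ik = rrb-free i j k i≢j j≢k i≢k
    (rrb , refl , pattern-rrb)
    where
    pattern-rrb : HasPattern c i j k rrb
    pattern-rrb rewrite ij | jk | ik = _↭_.refl

  -- As an implication it holds vacuously at `j = i`, which closes the neighborhood without
  -- consulting the meaningless diagonal color.
  ClosedRed : Fin n → Pred (Fin n) 0ℓ
  ClosedRed i j = i ≢ j → color c i j ≡ r

  closedRed? : ∀ i → Decidable (ClosedRed i)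
  closedRed? i j = ¬? (i ≟ j) →-dec (color c i j ≟ᶜ r)

  redNeighborhood : Fin n → Subset n
  redNeighborhood i = subsetOf (closedRed? i)

  redNeighborhood-sym : ∀ {i j} → j ∈ redNeighborhood i → i ∈ redNeighborhood j
  redNeighborhood-sym {i} {j} j∈ = ∈-subsetOf⁺ (closedRed? j) λ j≢i →
    trans (color-sym c j i) (∈-subsetOf⁻ (closedRed? i) j∈ (≢-sym j≢i))

  redNeighborhood-avoids-b : ∀ v → Avoids c (redNeighborhood v) b
  redNeighborhood-avoids-b v {i} {j} i∈ j∈ i≢j ij
    with ∈-subsetOf⁻ (closedRed? v) i∈ | ∈-subsetOf⁻ (closedRed? v) j∈
       | v ≟ i | v ≟ j
  ... | _  | vj | yes refl | _        = contradiction (trans (sym ij) (vj i≢j)) λ ()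
  ... | vi | _  | no v≢i   | yes refl =
    contradiction (trans (sym ij) (trans (color-sym c i v) (vi v≢i))) λ ()
  -- Here `i`, `v`, `j` is a red path, so `red²` forbids a blue edge from `i` to `j`.
  ... | vi | vj | no v≢i   | no v≢j   =
    red² (≢-sym v≢i) v≢j i≢j (trans (color-sym c i v) (vi v≢i)) (vj v≢j) ij

  n≤h₂² : n ≤ h₂ c * h₂ c
  n≤h₂² with largeIndependentSet redNeighborhood
    (λ i → ∈-subsetOf⁺ (closedRed? i) λ i≢i → contradiction refl i≢i)
    redNeighborhood-sym
    (λ i → avoids⇒∣S∣≤h₂ c (redNeighborhood-avoids-b i))
  -- Independence rules out red edges, so `I` avoids `r` and `∣ I ∣` is at most `h₂ c` too.
  ... | I , indep , n≤ = ≤-trans n≤ (*-monoˡ-≤ (h₂ c) (avoids⇒∣S∣≤h₂ c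
    λ {i} i∈ j∈ i≢j ij → indep i∈ j∈ i≢j (∈-subsetOf⁺ (closedRed? i) λ _ → ij)))

-- The `b` must land in one of the three positions; deleting it from both sides leaves a permutation
-- of two copies of `r`.
rrb-↭ : ∀ {p q s} → r ∷ r ∷ b ∷ [] ↭ p ∷ q ∷ s ∷ [] →
        (p ≡ b × q ≡ r × s ≡ r) ⊎ (p ≡ r × q ≡ b × s ≡ r) ⊎ (p ≡ r × q ≡ r × s ≡ b)
rrb-↭ {p} {q} σ with Any-resp-↭ {P = b ≡_} σ (there (there (here refl)))
... | here refl
  with q≡r ∷ s≡r ∷ [] ←
    All-resp-↭ {P = _≡ r} (drop-mid (r ∷ r ∷ []) [] σ)
      (refl ∷ refl ∷ [])
  = inj₁ (refl , q≡r , s≡r)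
... | there (here refl)
  with p≡r ∷ s≡r ∷ [] ←
    All-resp-↭ {P = _≡ r} (drop-mid (r ∷ r ∷ []) (p ∷ []) σ)
      (refl ∷ refl ∷ [])
  = inj₂ (inj₁ (p≡r , refl , s≡r))
... | there (there (here refl))
  with p≡r ∷ q≡r ∷ [] ←
    All-resp-↭ {P = _≡ r} (drop-mid (r ∷ r ∷ []) (p ∷ q ∷ []) σ)
      (refl ∷ refl ∷ [])
  = inj₂ (inj₂ (p≡r , q≡r , refl))

-- The grid coloring for the upper bound.

module Grid (row col : Fin n → Fin m)
            (cell-injective : ∀ {i j} → row i ≡ row j → col i ≡ col j → i ≡ j)
            where

  -- Both flags are true only on the diagonal, since distinct vertices occupy distinct cells.
  cellColor : (sameRow sameCol : Bool) → Color
  cellColor true  _     = r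
  cellColor false true  = b
  cellColor false false = y

  grid : EdgeColoring n
  grid .color i j = cellColor (does (row i ≟ row j)) (does (col i ≟ col j))
  grid .color-sym i j = cong₂ cellColor
    (does-⇔ (mk⇔ sym sym) (row i ≟ row j) (row j ≟ row i))
    (does-⇔ (mk⇔ sym sym) (col i ≟ col j) (col j ≟ col i))

  sameRow⇒red : ∀ {i j} → row i ≡ row j → color grid i j ≡ r
  sameRow⇒red {i} {j} eq rewrite dec-true (row i ≟ row j) eq = refl

  red⇒sameRow : ∀ {i j} → color grid i j ≡ r → row i ≡ row j
  red⇒sameRow {i} {j} red with row i ≟ row j | col i ≟ col j
  ... | yes eq | _ = eq
  red⇒sameRow () | no _ | yes _
  red⇒sameRow () | no _ | no _

  sameCol⇒blue : ∀ {i j} → i ≢ j → col i ≡ col j → color grid i j ≡ b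
  sameCol⇒blue {i} {j} i≢j eq with row i ≟ row j | col i ≟ col j
  ... | yes eq′ | _     = contradiction (cell-injective eq′ eq) i≢j
  ... | no _    | yes _ = refl
  ... | no _    | no ≢  = contradiction eq ≢

  nonYellow⇒sameRow⊎sameCol : ∀ {i j} → color grid i j ≢ y →
                              row i ≡ row j ⊎ col i ≡ col j
  nonYellow⇒sameRow⊎sameCol {i} {j} ≢y with row i ≟ row j | col i ≟ col j
  ... | yes eq | _      = inj₁ eq
  ... | no _   | yes eq = inj₂ eq
  ... | no _   | no _   = contradiction refl ≢y

  -- Red means sharing a row, an equivalence relation, so two red edges of a triangle force the
  -- third to be red, wherever the blue edge was supposed to be.
  grid-rrb-free : Forb n ｛ rrb ｝ grid
  grid-rrb-free i j k _ _ _ (_ , refl , σ) with rrb-↭ σ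
  ... | inj₁ (ij , jk , ik) = contradiction
    (trans (sym ij) (sameRow⇒red (trans (red⇒sameRow ik) (sym (red⇒sameRow jk))))) λ ()
  ... | inj₂ (inj₁ (ij , jk , ik)) = contradiction
    (trans (sym jk) (sameRow⇒red (trans (sym (red⇒sameRow ij)) (red⇒sameRow ik)))) λ ()
  ... | inj₂ (inj₂ (ij , jk , ik)) = contradiction
    (trans (sym ik) (sameRow⇒red (trans (red⇒sameRow ij) (red⇒sameRow jk)))) λ ()

  -- For z = y: if two vertices of S share a column, a vertex outside that
  -- column would have to share its row with both, so S lies in one column.
  avoids⇒∣S∣≤m : ∀ {S} z → Avoids grid S z → ∣ S ∣ ≤ m
  avoids⇒∣S∣≤m r avoids = injectiveOn⇒∣p∣≤m {f = row} λ {i} {j} i∈ j∈ eq →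
    decidable-stable (i ≟ j) λ i≢j → avoids i∈ j∈ i≢j (sameRow⇒red eq)
  avoids⇒∣S∣≤m b avoids = injectiveOn⇒∣p∣≤m {f = col} λ {i} {j} i∈ j∈ eq →
    decidable-stable (i ≟ j) λ i≢j → avoids i∈ j∈ i≢j (sameCol⇒blue i≢j eq)
  avoids⇒∣S∣≤m {S} y avoids
    with Fin.any? (λ i → Fin.any? (λ j →
      (i ∈? S) ×-dec (j ∈? S) ×-dec ¬? (i ≟ j) ×-dec (col i ≟ col j)))
  ... | no none = injectiveOn⇒∣p∣≤m {f = col} λ {i} {j} i∈ j∈ eq →
    decidable-stable (i ≟ j) λ i≢j → none (i , j , i∈ , j∈ , i≢j , eq)
  ... | yes (i , j , i∈ , j∈ , i≢j , ij) = injectiveOn⇒∣p∣≤m {f = row}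
    λ k∈ l∈ eq → cell-injective eq (trans (inColumn k∈) (sym (inColumn l∈)))
    where
    inLine : ∀ {k l} → k ∈ S → l ∈ S → row k ≡ row l ⊎ col k ≡ col l
    inLine {k} {l} k∈ l∈ with k ≟ l
    ... | yes refl = inj₁ refl
    ... | no k≢l   = nonYellow⇒sameRow⊎sameCol (avoids k∈ l∈ k≢l)

    inColumn : ∀ {k} → k ∈ S → col k ≡ col i
    inColumn k∈ with inLine k∈ i∈ | inLine k∈ j∈
    ... | inj₂ ki | _       = ki
    ... | inj₁ _  | inj₂ kj = trans kj (sym ij)
    -- Then `i` and `j` share a row as well as a column, so they coincide.
    ... | inj₁ ki | inj₁ kj =
      contradiction (cell-injective (trans (sym ki) kj) ij) i≢j

  h₂≤m : h₂ grid ≤ m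
  h₂≤m with maxTwoColoredSet grid
  ... | _ , (S , refl , two) , _ with atMostTwoColors⇒avoids grid two
  ... | z , avoids = avoids⇒∣S∣≤m z avoids

-- Since `n ≤ m * m`, the vertices embed into `Fin (m * m)`; quotient and remainder by `m` serve as
-- row and column, and `combine` recovers the vertex from them.
rrb-free-with-h₂≤ : n ≤ m * m → ∃[ c ] Forb n ｛ rrb ｝ c × h₂ c ≤ m
rrb-free-with-h₂≤ {n} {m} n≤m² = grid , grid-rrb-free , h₂≤m
  where
  cell : Fin n → Fin m × Fin m
  cell i = remQuot m (inject≤ i n≤m²)

  cell-injective : ∀ {i j} → proj₁ (cell i) ≡ proj₁ (cell j) →
                   proj₂ (cell i) ≡ proj₂ (cell j) → i ≡ j
  cell-injective {i} {j} row≡ col≡ = Fin.inject≤-injective n≤m² n≤m² i j (begin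
    inject≤ i n≤m²            ≡⟨ Fin.combine-remQuot {m} m _ ⟨
    uncurry combine (cell i)  ≡⟨ cong₂ combine row≡ col≡ ⟩
    uncurry combine (cell j)  ≡⟨ Fin.combine-remQuot {m} m _ ⟩
    inject≤ j n≤m²            ∎)
    where open ≡-Reasoning

  open Grid (proj₁ ∘ cell) (proj₂ ∘ cell) cell-injective

lemma1p2 : ∀ (n : ℕ) .{{_ : NonZero n}} → h₂[ n , ｛ rrb ｝ ]≡ ⌈√ n ⌉
lemma1p2 n with ceilSqrt n
... | m , n≤m² , least with rrb-free-with-h₂≤ n≤m²
... | c , rrb-free , h₂≤m =
  -- The lower bound makes `h₂ c` a number whose square is at least `n`, and `m` is the least such
  -- number.
  (c , rrb-free , ≤-antisym h₂≤m (least _ (n≤h₂² c rrb-free))) ,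
  λ { _ (c , rrb-free , refl) → least _ (n≤h₂² c rrb-free) }
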